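{- Let $F$ be a one-dimensional tropical fan in $\mathbb{R}^n$ whose rays span $\mathbb{R}^n$, let $u_1,u_2,u_3$ be primitive generators of rays of $F$, and let $l,h\in(\mathbb{Z}^n)^\vee$. If $g_l(u_1,u_2)\in\mathrm{Gly}(F)$, $g_h(u_1,u_3)\in\mathrm{Gly}(F)$ and $u_2\ne u_3$, then $g_f(u_2,u_3)\in\mathrm{Gly}(F)$ for some $f\in(\mathbb{Z}^n)^\vee$.
   Context: A one-dimensional tropical fan $F$ in $\mathbb{R}^n$ consists of finitely many distinct rays $\mathbb{R}_+v_1,\dots,\mathbb{R}_+v_q$ (and the origin), with $v_i\in\mathbb{Z}^n$ primitive, together with positive integer weights $\omega_1,\dots,\omega_q$ satisfying the balancing condition $\sum_i\omega_iv_i=0$. For $l\in(\mathbb{Z}^n)^\vee$ put $\max(0,l)\cdot F=\sum_i\omega_i\max(0,l(v_i))$. If this equals $1$, the gallery of $F$ over $\max(0,l)$ is the set of rays $\mathbb{R}_+v_i$ of $F$ with $|l(v_i)|=1$. $\mathrm{Gly}(F)$ is the set of all galleries of $F$. The notation $g_l(v_a,v_b)\in\mathrm{Gly}(F)$ means that $\max(0,l)\cdot F=1$, that the gallery over $\max(0,l)$ is $\{\mathbb{R}_+v_a,\mathbb{R}_+v_b\}$, and that $l(v_a)=1$, $l(v_b)=-1$; equivalently, $l(v_a)=1$, $l(v_b)=-1$, $\omega_a=\omega_b=1$ and $l(v_i)=0$ for all $i\ne a,b$. -}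

module Defs where

open import Algebra.Bundles.Raw using (RawGroup)
open import Algebra.Morphism.Structures using (module GroupMorphisms)
open import Data.Fin.Base using (Fin)
open import Data.Integer.Base as ℤ using (ℤ; 0ℤ; 1ℤ; -1ℤ; +_; ∣_∣)
open import Data.Nat.Base as ℕ using (ℕ)
open import Data.Nat.GCD using (gcd)
open import Data.Product.Base using (Σ-syntax; _×_)
open import Data.Rational.Base as ℚ using (ℚ; 0ℚ)
open import Data.Vec.Base using (Vec; map; zipWith; replicate; foldr′)
open import Level using (0ℓ)
open import Relation.Binary.PropositionalEquality.Core using (_≡_; _≢_)
open import Relation.Nullary.Negation.Core using (¬_)
open import Relation.Unary using (Pred; ｛_｝; _∪_; _≐_)
import Algebra.Definitions.RawMonoid as RawMonoidDefs

ℤ^ : ℕ → RawGroup 0ℓ 0ℓ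
ℤ^ n = record
  { Carrier = Vec ℤ n
  ; _≈_     = _≡_
  ; _∙_     = zipWith ℤ._+_
  ; ε       = replicate n 0ℤ
  ; _⁻¹     = map (λ z → ℤ.- z)
  }

ℚ^ : ℕ → RawGroup 0ℓ 0ℓ
ℚ^ n = record
  { Carrier = Vec ℚ n
  ; _≈_     = _≡_
  ; _∙_     = zipWith ℚ._+_
  ; ε       = replicate n 0ℚ
  ; _⁻¹     = map (λ z → ℚ.- z)
  }

module ℤ-Sum = RawMonoidDefs (RawGroup.rawMonoid ℤ.+-0-rawGroup) using (sum)
module ℤ^-Sum (n : ℕ) = RawMonoidDefs (RawGroup.rawMonoid (ℤ^ n)) using (sum) renaming (_×_ to _·_)
module ℚ^-Sum (n : ℕ) = RawMonoidDefs (RawGroup.rawMonoid (ℚ^ n)) using (sum)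

record Dual (n : ℕ) : Set where
  open GroupMorphisms (ℤ^ n) ℤ.+-0-rawGroup
  field
    ⟦_⟧            : Vec ℤ n → ℤ
    isHomomorphism : IsGroupHomomorphism ⟦_⟧

open Dual public using (⟦_⟧)

-- The zero vector has gcd 0, so it is not primitive.

Primitive : ∀ {n} → Vec ℤ n → Set
Primitive v = foldr′ gcd 0 (map ∣_∣ v) ≡ 1

infixr 7 _•_

_•_ : ∀ {n} → ℚ → Vec ℤ n → Vec ℚ n
c • v = map (λ z → c ℚ.* (z ℚ./ 1)) v

-- The rational points of the ray ℝ₊ v.  For integral v these determine the
-- ray.

ray : ∀ {n} → Vec ℤ n → Pred (Vec ℚ n) 0ℓ
ray v x = Σ[ c ∈ ℚ ] (0ℚ ℚ.≤ c × x ≡ c • v)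

record TropicalFan (n : ℕ) : Set where
  open ℤ^-Sum n
  field
    q         : ℕ
    v         : Fin q → Vec ℤ n
    ω         : Fin q → ℕ
    isPrim    : ∀ i → Primitive (v i)
    distinct  : ∀ i j → i ≢ j → ¬ (ray (v i) ≐ ray (v j))
    positive  : ∀ i → 0 ℕ.< ω i
    balanced  : sum (λ i → ω i · v i) ≡ replicate n 0ℤ

module _ {n : ℕ} (F : TropicalFan n) where
  open TropicalFan F

  -- Spanning of ℚⁿ over ℚ; for vectors in ℤⁿ this is the same as spanning
  -- ℝⁿ over ℝ.

  RaysSpan : Set
  RaysSpan = ∀ (x : Vec ℚ n) → Σ[ c ∈ (Fin q → ℚ) ] x ≡ ℚ^-Sum.sum n (λ i → c i • v i)

  max0·_ : Dual n → ℤ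
  max0· l = ℤ-Sum.sum (λ i → + ω i ℤ.* (0ℤ ℤ.⊔ ⟦ l ⟧ (v i)))

  -- Rays of F are identified with their indices, by distinctness.

  gallery : Dual n → Pred (Fin q) 0ℓ
  gallery l i = ∣ ⟦ l ⟧ (v i) ∣ ≡ 1

  -- g l a b is the assertion g_l(v_a, v_b) ∈ Gly(F).

  record g (l : Dual n) (a b : Fin q) : Set where
    field
      degree-one : max0· l ≡ 1ℤ
      is-pair    : gallery l ≐ ｛ a ｝ ∪ ｛ b ｝
      at-a       : ⟦ l ⟧ (v a) ≡ 1ℤ
      at-b       : ⟦ l ⟧ (v b) ≡ -1ℤ

{-# OPTIONS --safe #-}

-- In g_l(v_a, v_b) the degree condition leaves room for only one positive term,
-- so ω_a = 1 and l ≤ 0 off a.  By balancing, max(0,l) and max(0,-l) have the same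
-- degree, so likewise ω_b = 1 and l ≥ 0 off b.  Hence l is the difference of the
-- indicators of a and b on the rays, and f = h - l is that of a₂ and a₃.

module Submission where

open import Defs
open import Algebra.Morphism.Structures using (module GroupMorphisms)
open import Data.Fin.Base using (Fin; punchIn; punchOut)
open import Data.Fin.Properties using (_≟_; punchIn-punchOut; punchInᵢ≢i)
open import Data.Integer.Base hiding (suc; positive)
open import Data.Integer.Properties hiding (_≟_)
open import Data.Nat.Base using (ℕ; zero; suc)
open import Data.Product.Base using (Σ-syntax; _,_)
open import Data.Sum.Base using ([_,_]′; inj₁; inj₂)
open import Data.Vec.Functional using (removeAt)
open import Function.Base using (_∘_)
open import Relation.Binary.PropositionalEquality
open import Relation.Nullary using (yes; no; contradiction)
open import Relation.Unary using (｛_｝; _∪_)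
import Data.Nat.Properties as ℕ
open import Algebra.Properties.CommutativeMonoid.Sum +-0-commutativeMonoid
  using (sum; sum-remove; sum-cong-≗; sum-replicate-zero; ∑-distrib-+)
open import Algebra.Properties.CommutativeSemigroup +-commutativeSemigroup
  using (interchange)
open import Algebra.Properties.AbelianGroup +-0-abelianGroup using (identityʳ-unique)

-- Finite sums of nonnegative integers

sum-nonNeg : ∀ {n} (t : Fin n → ℤ) → (∀ i → 0ℤ ≤ t i) → 0ℤ ≤ sum t
sum-nonNeg {zero}  t 0≤t = ≤-refl
sum-nonNeg {suc n} t 0≤t =
  +-mono-≤ (0≤t Fin.zero) (sum-nonNeg (t ∘ Fin.suc) (0≤t ∘ Fin.suc))

term≤sum : ∀ {n} (t : Fin n → ℤ) → (∀ i → 0ℤ ≤ t i) → ∀ i → t i ≤ sum t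
term≤sum {suc n} t 0≤t i = begin
  t i                       ≡⟨ +-identityʳ (t i) ⟨
  t i + 0ℤ                  ≤⟨ +-monoʳ-≤ (t i) (sum-nonNeg (removeAt t i) (0≤t ∘ punchIn i)) ⟩
  t i + sum (removeAt t i)  ≡⟨ sum-remove t ⟨
  sum t                     ∎
  where open ≤-Reasoning

sum-supported : ∀ {n} (t : Fin n → ℤ) a → (∀ i → i ≢ a → t i ≡ 0ℤ) → sum t ≡ t a
sum-supported {suc n} t a t≡0 = begin
  sum t     ≡⟨ sum-remove t ⟩
  t a + _   ≡⟨ cong (λ s → t a + s) (sum-cong-≗ (λ j → t≡0 _ (punchInᵢ≢i a j))) ⟩
  t a + _   ≡⟨ cong (λ s → t a + s) (sum-replicate-zero n) ⟩
  t a + 0ℤ  ≡⟨ +-identityʳ (t a) ⟩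
  t a       ∎
  where open ≡-Reasoning

-- Removing the term at `a` leaves a nonnegative family of sum zero, and each of its terms is
-- bounded by that sum.
sum≡term⇒others≡0 : ∀ {n} (t : Fin n → ℤ) a → (∀ i → 0ℤ ≤ t i) →
                    sum t ≡ t a → ∀ i → i ≢ a → t i ≡ 0ℤ
sum≡term⇒others≡0 {suc n} t a 0≤t eq i i≢a = ≤-antisym tᵢ≤0 (0≤t i)
  where
  a≢i = i≢a ∘ sym
  rest≡0 = identityʳ-unique (t a) _ (trans (sym (sum-remove t)) eq)
  tᵢ≤0 : t i ≤ 0ℤ
  tᵢ≤0 = subst₂ _≤_ (cong t (punchIn-punchOut a≢i)) rest≡0
    (term≤sum (removeAt t a) (0≤t ∘ punchIn a) (punchOut a≢i))

-- The splitting of an integer into positive and negative parts. It serves to compare the degrees of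
-- `l` and `⊟ l`, and to recover a value of `l` once both parts are known to vanish.
pos-part-identity : ∀ x → 0ℤ ⊔ x ≡ x + (0ℤ ⊔ - x)
pos-part-identity +0       = refl
pos-part-identity +[1+ n ] = sym (+-identityʳ +[1+ n ])
pos-part-identity -[1+ n ] = sym (+-inverseˡ +[1+ n ])

-- Differences of dual vectors, and linearity over weighted sums

module _ {n : ℕ} where
  open GroupMorphisms (ℤ^ n) +-0-rawGroup using (module IsGroupHomomorphism)
  module Hom (l : Dual n) = IsGroupHomomorphism (Dual.isHomomorphism l)

  infixl 6 _⊞_

  _⊞_ : Dual n → Dual n → Dual n
  l ⊞ h = record
    { ⟦_⟧ = λ x → ⟦ l ⟧ x + ⟦ h ⟧ x
    ; isHomomorphism = record
      { isMonoidHomomorphism = record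
        { isMagmaHomomorphism = record
          { isRelHomomorphism = record { cong = cong _ }
          ; homo = λ x y → trans (cong₂ _+_ (Hom.homo l x y) (Hom.homo h x y))
                                 (interchange (⟦ l ⟧ x) _ _ _)
          }
        ; ε-homo = cong₂ _+_ (Hom.ε-homo l) (Hom.ε-homo h)
        }
      ; ⁻¹-homo = λ x → trans (cong₂ _+_ (Hom.⁻¹-homo l x) (Hom.⁻¹-homo h x))
                              (sym (neg-distrib-+ (⟦ l ⟧ x) _))
      }
    }

  ⊟_ : Dual n → Dual n
  ⊟ l = record
    { ⟦_⟧ = λ x → - ⟦ l ⟧ x
    ; isHomomorphism = record
      { isMonoidHomomorphism = record
        { isMagmaHomomorphism = record
          { isRelHomomorphism = record { cong = cong _ }
          ; homo = λ x y → trans (cong -_ (Hom.homo l x y)) (neg-distrib-+ (⟦ l ⟧ x) _)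
          }
        ; ε-homo = cong -_ (Hom.ε-homo l)
        }
      ; ⁻¹-homo = λ x → cong -_ (Hom.⁻¹-homo l x)
      }
    }

  open ℤ^-Sum n using (_·_) renaming (sum to sumᵛ)

  dual-· : ∀ (l : Dual n) k x → ⟦ l ⟧ (k · x) ≡ + k * ⟦ l ⟧ x
  dual-· l zero    x = Hom.ε-homo l
  dual-· l (suc k) x = begin
    ⟦ l ⟧ (suc k · x)        ≡⟨ Hom.homo l x (k · x) ⟩
    ⟦ l ⟧ x + ⟦ l ⟧ (k · x)  ≡⟨ cong (λ y → ⟦ l ⟧ x + y) (dual-· l k x) ⟩
    ⟦ l ⟧ x + + k * ⟦ l ⟧ x  ≡⟨ suc-* (+ k) (⟦ l ⟧ x) ⟨
    + suc k * ⟦ l ⟧ x        ∎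
    where open ≡-Reasoning

  dual-sum : ∀ (l : Dual n) {q} (x : Fin q → _) → ⟦ l ⟧ (sumᵛ x) ≡ sum (⟦ l ⟧ ∘ x)
  dual-sum l {zero}  x = Hom.ε-homo l
  dual-sum l {suc q} x =
    trans (Hom.homo l _ _) (cong (λ y → ⟦ l ⟧ (x Fin.zero) + y) (dual-sum l (x ∘ Fin.suc)))

-- Degrees and galleries on a balanced fan

module _ {n : ℕ} (F : TropicalFan n) where
  open TropicalFan F

  max0-term : Dual n → Fin q → ℤ
  max0-term l i = + ω i * (0ℤ ⊔ ⟦ l ⟧ (v i))

  max0-term-nonNeg : ∀ l i → 0ℤ ≤ max0-term l i
  max0-term-nonNeg l i = subst (_≤ max0-term l i) (*-zeroʳ (+ ω i))
    (*-monoˡ-≤-nonNeg (+ ω i) (i≤i⊔j 0ℤ (⟦ l ⟧ (v i))))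

  dual-balanced : ∀ l → sum (λ i → + ω i * ⟦ l ⟧ (v i)) ≡ 0ℤ
  dual-balanced l = begin
    sum (λ i → + ω i * ⟦ l ⟧ (v i))       ≡⟨ sum-cong-≗ (λ i → dual-· l (ω i) (v i)) ⟨
    sum (λ i → ⟦ l ⟧ (ω i · v i))         ≡⟨ dual-sum l (λ i → ω i · v i) ⟨
    ⟦ l ⟧ (ℤ^-Sum.sum n λ i → ω i · v i)  ≡⟨ cong ⟦ l ⟧ balanced ⟩
    ⟦ l ⟧ _                               ≡⟨ Hom.ε-homo l ⟩
    0ℤ                                    ∎
    where
    open ≡-Reasoning
    open ℤ^-Sum n using (_·_)

  -- The two degrees differ by the weighted sum of the values of `l`, which balancing kills. This
  -- symmetry carries every conclusion about the positive end `a` over to the negative end `b`.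
  max0-⊟ : ∀ l → max0·_ F (⊟ l) ≡ max0·_ F l
  max0-⊟ l = sym (begin
    sum (max0-term l)
      ≡⟨ sum-cong-≗ (λ i → trans (cong (+ ω i *_) (pos-part-identity (⟦ l ⟧ (v i))))
                                 (*-distribˡ-+ (+ ω i) (⟦ l ⟧ (v i)) _)) ⟩
    sum (λ i → + ω i * ⟦ l ⟧ (v i) + max0-term (⊟ l) i)
      ≡⟨ ∑-distrib-+ (λ i → + ω i * ⟦ l ⟧ (v i)) (max0-term (⊟ l)) ⟩
    sum (λ i → + ω i * ⟦ l ⟧ (v i)) + sum (max0-term (⊟ l))
      ≡⟨ cong (_+ sum (max0-term (⊟ l))) (dual-balanced l) ⟩
    0ℤ + sum (max0-term (⊟ l))
      ≡⟨ +-identityˡ _ ⟩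
    sum (max0-term (⊟ l)) ∎)
    where open ≡-Reasoning

  max0-term-at-1 : ∀ l {a} → ⟦ l ⟧ (v a) ≡ 1ℤ → max0-term l a ≡ + ω a
  max0-term-at-1 l {a} la≡1 =
    trans (cong (λ x → + ω a * (0ℤ ⊔ x)) la≡1) (*-identityʳ (+ ω a))

  degree-one⇒ω≡1 : ∀ l {a} → max0·_ F l ≡ 1ℤ → ⟦ l ⟧ (v a) ≡ 1ℤ → ω a ≡ 1
  degree-one⇒ω≡1 l {a} deg la≡1 = ℕ.≤-antisym
    (drop‿+≤+ (subst₂ _≤_ (max0-term-at-1 l la≡1) deg
      (term≤sum (max0-term l) (max0-term-nonNeg l) a)))
    (positive a)

  -- The term at `a` already exhausts the degree, so every other term is zero; its weight is
  -- positive, so the other factor must vanish.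
  degree-one⇒pos-part≡0 : ∀ l {a} → max0·_ F l ≡ 1ℤ → ⟦ l ⟧ (v a) ≡ 1ℤ →
                          ∀ i → i ≢ a → 0ℤ ⊔ ⟦ l ⟧ (v i) ≡ 0ℤ
  degree-one⇒pos-part≡0 l {a} deg la≡1 i i≢a =
    [ (λ ωᵢ≡0 → contradiction (sym (+-injective ωᵢ≡0)) (ℕ.<⇒≢ (positive i)))
    , (λ eq → eq) ]′ (i*j≡0⇒i≡0∨j≡0 (+ ω i) termᵢ≡0)
    where
    degree≡termₐ : max0·_ F l ≡ max0-term l a
    degree≡termₐ = trans deg (sym (trans (max0-term-at-1 l la≡1)
                                         (cong +_ (degree-one⇒ω≡1 l deg la≡1))))
    termᵢ≡0 : max0-term l i ≡ 0ℤ
    termᵢ≡0 = sum≡term⇒others≡0 (max0-term l) a (max0-term-nonNeg l) degree≡termₐ i i≢a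

  -- A pointwise form of `g`. Unlike the degree and the gallery, values on rays are additive in `l`,
  -- so two such records can be subtracted.
  record IsPair (l : Dual n) (a b : Fin q) : Set where
    field
      ω-a   : ω a ≡ 1
      ω-b   : ω b ≡ 1
      at-a  : ⟦ l ⟧ (v a) ≡ 1ℤ
      at-b  : ⟦ l ⟧ (v b) ≡ -1ℤ
      other : ∀ i → i ≢ a → i ≢ b → ⟦ l ⟧ (v i) ≡ 0ℤ

    a≢b : a ≢ b
    a≢b refl with () ← trans (sym at-a) at-b

  g⇒IsPair : ∀ {l a b} → g F l a b → IsPair l a b
  g⇒IsPair {l} {a} {b} p = record
    { ω-a   = degree-one⇒ω≡1 l degree-one at-a
    ; ω-b   = degree-one⇒ω≡1 (⊟ l) degree-one⁻ at-b⁻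
    ; at-a  = at-a
    ; at-b  = at-b
    ; other = λ i i≢a i≢b → begin
        ⟦ l ⟧ (v i)
          ≡⟨ +-identityʳ _ ⟨
        -- The added zero is read as the negative part, which vanishes off `b`; the sum is then the
        -- positive part, which vanishes off `a`.
        ⟦ l ⟧ (v i) + 0ℤ
          ≡⟨ cong (λ y → ⟦ l ⟧ (v i) + y) (degree-one⇒pos-part≡0 (⊟ l) degree-one⁻ at-b⁻ i i≢b) ⟨
        ⟦ l ⟧ (v i) + (0ℤ ⊔ - ⟦ l ⟧ (v i))
          ≡⟨ pos-part-identity (⟦ l ⟧ (v i)) ⟨
        0ℤ ⊔ ⟦ l ⟧ (v i)
          ≡⟨ degree-one⇒pos-part≡0 l degree-one at-a i i≢a ⟩
        0ℤ ∎
    }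
    where
    open g p
    open ≡-Reasoning
    degree-one⁻ : max0·_ F (⊟ l) ≡ 1ℤ
    degree-one⁻ = trans (max0-⊟ l) degree-one
    at-b⁻ : ⟦ ⊟ l ⟧ (v b) ≡ 1ℤ
    at-b⁻ = cong -_ at-b

  IsPair⇒g : ∀ {l a b} → IsPair l a b → g F l a b
  IsPair⇒g {l} {a} {b} p = record
    { degree-one = begin
        sum (max0-term l)  ≡⟨ sum-supported (max0-term l) a term≡0 ⟩
        max0-term l a      ≡⟨ max0-term-at-1 l at-a ⟩
        + ω a              ≡⟨ cong +_ ω-a ⟩
        1ℤ                 ∎
    ; is-pair = (λ {i} → to i) , λ where
        (inj₁ refl) → cong ∣_∣ at-a
        (inj₂ refl) → cong ∣_∣ at-b
    ; at-a = at-a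
    ; at-b = at-b
    }
    where
    open IsPair p
    open ≡-Reasoning

    pos-part≡0 : ∀ i → i ≢ a → 0ℤ ⊔ ⟦ l ⟧ (v i) ≡ 0ℤ
    pos-part≡0 i i≢a with i ≟ b
    -- The value -1 at `b` is cut off by the maximum, so `a` alone contributes to the degree.
    ... | yes refl = cong (0ℤ ⊔_) at-b
    ... | no  i≢b  = cong (0ℤ ⊔_) (other i i≢a i≢b)

    term≡0 : ∀ i → i ≢ a → max0-term l i ≡ 0ℤ
    term≡0 i i≢a = trans (cong (+ ω i *_) (pos-part≡0 i i≢a)) (*-zeroʳ (+ ω i))

    to : ∀ i → gallery F l i → (｛ a ｝ ∪ ｛ b ｝) i
    to i ∣l∣≡1 with i ≟ a | i ≟ b
    ... | yes i≡a | _       = inj₁ (sym i≡a)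
    ... | no _    | yes i≡b = inj₂ (sym i≡b)
    ... | no i≢a  | no i≢b
      with () ← trans (sym ∣l∣≡1) (cong ∣_∣ (other i i≢a i≢b))

  -- The common positive end `a` cancels. Since `b` and `c` differ, `h` vanishes at `b` and `l` at
  -- `c`, so the values 0 - (-1) and -1 - 0 remain there.
  IsPair-difference : ∀ {l h a b c} → b ≢ c → IsPair l a b → IsPair h a c →
                      IsPair (h ⊞ ⊟ l) b c
  IsPair-difference {l} {h} {a} {b} {c} b≢c p r = record
    -- Both unit weights come from the negative ends of the given pairs.
    { ω-a   = P.ω-b
    ; ω-b   = R.ω-b
    ; at-a  = difference (R.other b (P.a≢b ∘ sym) b≢c) P.at-b
    ; at-b  = difference R.at-b (P.other c (R.a≢b ∘ sym) (b≢c ∘ sym))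
    ; other = other
    }
    where
    module P = IsPair p
    module R = IsPair r

    difference : ∀ {i x y} → ⟦ h ⟧ (v i) ≡ x → ⟦ l ⟧ (v i) ≡ y →
                 ⟦ h ⊞ ⊟ l ⟧ (v i) ≡ x - y
    -- The value of `h ⊞ ⊟ l` unfolds to a subtraction of integers.
    difference = cong₂ _-_

    other : ∀ i → i ≢ b → i ≢ c → ⟦ h ⊞ ⊟ l ⟧ (v i) ≡ 0ℤ
    other i i≢b i≢c with i ≟ a
    ... | yes refl = difference R.at-a P.at-a
    ... | no  i≢a  = difference (R.other i i≢a i≢c) (P.other i i≢a i≢b)

lemma3p5 : (n : ℕ) (F : TropicalFan n) → RaysSpan F →
    let open TropicalFan F in
    (a₁ a₂ a₃ : Fin q) (l h : Dual n) →
    g F l a₁ a₂ → g F h a₁ a₃ → v a₂ ≢ v a₃ →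
    Σ[ f ∈ Dual n ] g F f a₂ a₃
lemma3p5 n F _ a₁ a₂ a₃ l h gl gh v₂≢v₃ =
  h ⊞ ⊟ l ,
  -- Distinct generators have distinct indices, which is the form of the hypothesis needed here.
  IsPair⇒g F (IsPair-difference F (v₂≢v₃ ∘ cong v) (g⇒IsPair F gl) (g⇒IsPair F gh))
  where open TropicalFan F
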